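{- Let $\mathcal{R}$ be a set of admissible rewrite rules over simply typed $\lambda$-terms built from a set $\mathcal{F}$ of typed function symbols, such that for all $l\to r\in\mathcal{R}$ and $p\in\mathrm{FAP}(r)$, $\mathrm{FV}(r|_p)\subseteq\mathrm{FV}(r)$ and $r|_p$ has the type of $l$. Let $(>,\ge)$ be a higher-order reduction pair, that is, two relations on terms such that: - $>$ is well-founded and stable by substitution; - $\ge$ is a reflexive and transitive rewrite relation (i.e. stable by substitution and by context) containing $\to_\beta$; - ${\ge\circ>}\subseteq{>}$, i.e. $s\ge t$ and $t>u$ imply $s>u$. If ${\mathcal{R}}\subseteq{\ge}$ (i.e. $l\ge r$ for every rule $l\to r\in\mathcal{R}$) and ${\mathcal{DP}}\subseteq{>}$ (i.e. $l>t$ for every dependency pair $l\to t\in\mathcal{DP}$), then the relation ${\to_{\beta\mathrm{C}}}={\to_\beta}\cup{\to_{\mathrm{C}}}$ is terminating, where $\to_{\mathrm{C}}$ is the chain relation of $\mathcal{R}$.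
   Context: Terms and types. Simple types are built from base types with $\Rightarrow$. Terms are simply typed $\lambda$-terms (up to $\alpha$-equivalence) over typed variables and a set $\mathcal{F}$ of typed function symbols. The type of $f\in\mathcal{F}$ is written $\vec T\Rightarrow B=T_1\Rightarrow\dots\Rightarrow T_n\Rightarrow B$ with $B$ a base type. The notation $f\vec t$ means that $f$ is applied to a full sequence $\vec t=t_1,\dots,t_n$ of arguments of types $T_1,\dots,T_n$, so $f\vec t$ has type $B$. $\mathrm{FV}(t)$ is the set of free variables of $t$ (for a sequence, the union). Substitutions are type-preserving and capture-avoiding. Positions are words: in $\lambda x\,t$ the body is at position $1$; in $tu$, $t$ is at $1$ and $u$ at $2$; $t|_p$ is the subterm at $p$; $\varepsilon$ is the top position. A relation $\to$ is terminating (and $>$ is well-founded) if it admits no infinite sequence $a_0\to a_1\to\cdots$ (resp. $a_0>a_1>\cdots$). Rules. A rewrite rule has the form $f\vec l\to r$, where $f\in\mathcal{F}$ and both sides have the same type. $\mathcal{D}$ is the set of symbols $f$ occurring at the head of a left-hand side of a rule of $\mathcal{R}$. $\to_\beta$ is $\beta$-reduction (in any context). For a set of rules $S$, $\to_S$ is rewriting in any context: a subterm equal (up to $\alpha$) to $l\sigma$ is replaced by $r\sigma$, with $l\to r\in S$ and $\mathrm{dom}(\sigma)\subseteq\mathrm{FV}(l)$ (no matching modulo $\beta$ or $\eta$). Accessibility. $\mathrm{Pos}^+(B)=\{\varepsilon\}$, $\mathrm{Pos}^-(B)=\emptyset$ for base types $B$, and $\mathrm{Pos}^\delta(T\Rightarrow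 U)=1\cdot\mathrm{Pos}^{ -\delta}(T)\cup2\cdot\mathrm{Pos}^\delta(U)$ for $\delta\in\{+,-\}$; these are the positive and negative positions of a type. For $f:\vec T\Rightarrow B$, $\mathrm{Acc}(f)$ is the set of $i$ such that $B$ occurs in $T_i$ only at positive positions. Admissibility. For a sequence of terms $\vec t$, $\mathrm{PCC}(\vec t)$ is the least set of terms such that: (arg) each $t_i\in\mathrm{PCC}(\vec t)$; (acc) if $g\vec u\in\mathrm{PCC}(\vec t)$ and $i\in\mathrm{Acc}(g)$ then $u_i\in\mathrm{PCC}(\vec t)$; (lam) if $\lambda y\,u\in\mathrm{PCC}(\vec t)$ and $y\notin\mathrm{FV}(\vec t)$ then $u\in\mathrm{PCC}(\vec t)$; (app-left) if $uy\in\mathrm{PCC}(\vec t)$, $y$ a variable, $y\notin\mathrm{FV}(\vec t)\cup\mathrm{FV}(u)$, then $u\in\mathrm{PCC}(\vec t)$; (app-right) if $yu\in\mathrm{PCC}(\vec t)$, $y$ a variable of type $U\Rightarrow\vec T\Rightarrow U$ (for some type $U$ and sequence of types $\vec T$), $y\notin\mathrm{FV}(\vec t)\cup\mathrm{FV}(u)$, then $u\in\mathrm{PCC}(\vec t)$. A rule $f\vec l\to r$ is admissible if $\mathrm{FV}(r)\subseteq\mathrm{PCC}(\vec l)$. Full application positions. $\mathrm{FAP}(x)=\emptyset$ for a variable $x$ or a symbol $x\in\mathcal{F}\setminus\mathcal{D}$; $\mathrm{FAP}(\lambda x\,t)=1\cdot\mathrm{FAP}(t)$; if $f\in\mathcal{D}$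 and $n\ge0$ then $\mathrm{FAP}(ft_1\dots t_n)=\{\varepsilon\}\cup\bigcup_{i=1}^n1^{n-i}2\cdot\mathrm{FAP}(t_i)$; if $t$ is not of the form $ft_1\dots t_n$ with $f\in\mathcal{D}$, $n\ge 0$, then $\mathrm{FAP}(tu)=1\cdot\mathrm{FAP}(t)\cup2\cdot\mathrm{FAP}(u)$. Dependency pairs and chains. $\mathcal{DP}=\{l\to r|_p\mid l\to r\in\mathcal{R},\ p\in\mathrm{FAP}(r)\}$. Let $\to_{\mathcal{R}i}$ be the restriction of $\to_{\mathcal{R}}$ to non-top positions (the rewritten subterm is at a position $\neq\varepsilon$), and $\to_{\mathcal{DP}h}$ the restriction of $\to_{\mathcal{DP}}$ to the top position. The chain relation is ${\to_{\mathrm{C}}}={\to_{\mathcal{R}i}^*}\,{\to_{\mathcal{DP}h}}$ (finitely many, possibly zero, $\to_{\mathcal{R}i}$ steps followed by one $\to_{\mathcal{DP}h}$ step). -}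

module Defs where

open import Data.List.Base using (List; []; _∷_; foldr; _++_)
open import Data.List.Membership.Propositional using (_∈_; _∉_)
open import Data.List.Relation.Unary.All using (All; []; _∷_; lookup)
open import Data.List.Relation.Unary.Any using (here; there)
open import Data.Nat.Base using (ℕ; suc)
open import Data.Product.Base using (∃; ∃-syntax; _×_; _,_; proj₂)
open import Data.Sign.Base using (Sign; +; opposite)
open import Level using (Level; _⊔_) renaming (suc to ℓsuc)
open import Relation.Binary.Construct.Closure.ReflexiveTransitive using (Star)
open import Relation.Binary.Construct.Union using (_∪_)
open import Relation.Binary.Core using (Rel)
open import Relation.Binary.Indexed.Heterogeneous using (IRel; Reflexive; Transitive)
open import Relation.Binary.PropositionalEquality.Core using (_≡_; _≢_; refl)
open import Relation.Nullary.Negation.Core using (¬_)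

private
  variable
    a ℓ r ℓ₁ ℓ₂ : Level

Terminating : {A : Set a} → Rel A ℓ → Set (a ⊔ ℓ)
Terminating {A = A} _⟶_ = ¬ (∃ λ (s : ℕ → A) → ∀ n → s n ⟶ s (suc n))

-- The words over {1, 2} that serve as positions, in types and in terms.
data Direction : Set where
  𝟏 𝟐 : Direction

Position : Set
Position = List Direction

infixr 7 _⇒_

data Type {b} (Base : Set b) : Set b where
  base : Base → Type Base
  _⇒_  : Type Base → Type Base → Type Base

-- The symbol f has type dom f ⇒⃗ base (cod f), with _⇒⃗_ as below.
record Signature b f : Set (ℓsuc (b ⊔ f)) where
  field
    Base : Set b
    Fun  : Set f
    dom  : Fun → List (Type Base)
    cod  : Fun → Base

module HigherOrder {b f} (𝓢 : Signature b f) where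

  open Signature 𝓢 public

  Ty : Set b
  Ty = Type Base

  infixr 7 _⇒⃗_

  _⇒⃗_ : List Ty → Ty → Ty
  Ts ⇒⃗ U = foldr _⇒_ U Ts

  private
    variable
      B        : Base
      S T U    : Ty
      Ts Γ Δ   : List Ty
      δ        : Sign
      p q      : Position
      g        : Fun

  --------------------------------------------------------------------
  -- Accessible arguments

  data Pos : Sign → Ty → Position → Set b where
    base  : Pos + (base B) []
    left  : Pos (opposite δ) T p → Pos δ (T ⇒ U) (𝟏 ∷ p)
    right : Pos δ U p → Pos δ (T ⇒ U) (𝟐 ∷ p)

  data _OccursIn_At_ (B : Base) : Ty → Position → Set b where
    base  : B OccursIn base B At []
    left  : B OccursIn T At p → B OccursIn (T ⇒ U) At (𝟏 ∷ p)
    right : B OccursIn U At p → B OccursIn (T ⇒ U) At (𝟐 ∷ p)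

  Acc : (g : Fun) → T ∈ dom g → Set b
  Acc {T} g i = ∀ p → cod g OccursIn T At p → Pos + T p

  --------------------------------------------------------------------
  -- Terms

  -- Countably many variables of each type.
  record Var (T : Ty) : Set where
    constructor var
    field name : ℕ

  -- Locally nameless terms, so that α-equivalence is _≡_: bound variables
  -- are typed de Bruijn indices into Γ, free variables are named.
  data Term (Γ : List Ty) : Ty → Set (b ⊔ f) where
    free  : Var T → Term Γ T
    bound : T ∈ Γ → Term Γ T
    fun   : (g : Fun) → Term Γ (dom g ⇒⃗ base (cod g))
    lam   : Term (S ∷ Γ) T → Term Γ (S ⇒ T)
    app   : Term Γ (S ⇒ T) → Term Γ S → Term Γ T

  Tm : Ty → Set (b ⊔ f)
  Tm = Term []

  Args : List Ty → Set (b ⊔ f)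
  Args = All Tm

  apply : Tm (Ts ⇒⃗ U) → Args Ts → Tm U
  apply t []       = t
  apply t (u ∷ us) = apply (app t u) us

  infix 8 _$_

  _$_ : (g : Fun) → Args (dom g) → Tm (base (cod g))
  g $ ts = apply (fun g) ts

  data _∈FV_ {S} (x : Var S) : Term Γ T → Set (b ⊔ f) where
    free : x ∈FV free {Γ = Γ} x
    lam  : {t : Term (U ∷ Γ) T} → x ∈FV t → x ∈FV lam t
    appˡ : {t : Term Γ (U ⇒ T)} {u : Term Γ U} → x ∈FV t → x ∈FV app t u
    appʳ : {t : Term Γ (U ⇒ T)} {u : Term Γ U} → x ∈FV u → x ∈FV app t u

  infix 4 _∈FV_ _∉FV_ _∈FVs_ _∉FVs_

  _∉FV_ : Var S → Term Γ T → Set (b ⊔ f)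
  x ∉FV t = ¬ (x ∈FV t)

  _∈FVs_ : Var S → Args Ts → Set (b ⊔ f)
  x ∈FVs ts = ∃[ U ] ∃[ i ] x ∈FV lookup ts {U} i

  _∉FVs_ : Var S → Args Ts → Set (b ⊔ f)
  x ∉FVs ts = ¬ (x ∈FVs ts)

  --------------------------------------------------------------------
  -- Substitution

  Ren : List Ty → List Ty → Set b
  Ren Γ Δ = ∀ {S} → S ∈ Γ → S ∈ Δ

  liftᵣ : Ren Γ Δ → Ren (U ∷ Γ) (U ∷ Δ)
  liftᵣ ρ (here e)  = here e
  liftᵣ ρ (there i) = there (ρ i)

  ren : Ren Γ Δ → Term Γ T → Term Δ T
  ren ρ (free x)  = free x
  ren ρ (bound i) = bound (ρ i)
  ren ρ (fun g)   = fun g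
  ren ρ (lam t)   = lam (ren (liftᵣ ρ) t)
  ren ρ (app t u) = app (ren ρ t) (ren ρ u)

  BoundSub : List Ty → List Ty → Set (b ⊔ f)
  BoundSub Γ Δ = ∀ {S} → S ∈ Γ → Term Δ S

  FreeSub : List Ty → Set (b ⊔ f)
  FreeSub Δ = ∀ {S} → Var S → Term Δ S

  liftᵇ : BoundSub Γ Δ → BoundSub (U ∷ Γ) (U ∷ Δ)
  liftᵇ σ (here refl) = bound (here refl)
  liftᵇ σ (there i)   = ren there (σ i)

  liftᶠ : FreeSub Δ → FreeSub (U ∷ Δ)
  liftᶠ σ x = ren there (σ x)

  sub : BoundSub Γ Δ → FreeSub Δ → Term Γ T → Term Δ T
  sub β φ (free x)  = φ x
  sub β φ (bound i) = β i
  sub β φ (fun g)   = fun g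
  sub β φ (lam t)   = lam (sub (liftᵇ β) (liftᶠ φ) t)
  sub β φ (app t u) = app (sub β φ t) (sub β φ u)

  -- If x ∉FV t then lam t is the term λx. (t ⟨ free x ⟩); the named
  -- abstractions λx. u are exactly the terms of this form.
  _⟨_⟩ : Term (S ∷ []) T → Tm S → Tm T
  t ⟨ u ⟩ = sub (λ { (here refl) → u }) free t

  Subst : Set (b ⊔ f)
  Subst = FreeSub []

  infixl 9 _[_]

  _[_] : Tm T → Subst → Tm T
  t [ σ ] = sub bound σ t

  FiniteDomain : Subst → Set (b ⊔ f)
  FiniteDomain σ = ∃[ xs ] (∀ {S} (x : Var S) → (S , x) ∉ xs → σ x ≡ free x)

  -- dom(σ) ⊆ FV(t), where dom(σ) is the set of x such that xσ ≠ x.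
  Dom_⊆FV_ : Subst → Tm T → Set (b ⊔ f)
  Dom σ ⊆FV t = ∀ {S} (x : Var S) → x ∉FV t → σ x ≡ free x

  --------------------------------------------------------------------
  -- Contexts

  TermRel : (ℓ : Level) → Set (b ⊔ f ⊔ ℓsuc ℓ)
  TermRel ℓ = ∀ {T} → Rel (Tm T) ℓ

  -- Ctx R p s t: s and t differ by an R-step between their subterms at p.
  -- Under an abstraction, the bound variable gets a name x and may occur
  -- in both sides of the step: contexts capture.
  data Ctx (R : TermRel ℓ) : Position → Tm T → Tm T → Set (b ⊔ f ⊔ ℓ) where
    top  : {s t : Tm T} → R s t → Ctx R [] s t
    lam  : {s t : Term (S ∷ []) T} (x : Var S) → x ∉FV s → x ∉FV t →
           Ctx R p (s ⟨ free x ⟩) (t ⟨ free x ⟩) → Ctx R (𝟏 ∷ p) (lam s) (lam t)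
    appˡ : {s t : Tm (S ⇒ T)} {u : Tm S} →
           Ctx R p s t → Ctx R (𝟏 ∷ p) (app s u) (app t u)
    appʳ : {s : Tm (S ⇒ T)} {t u : Tm S} →
           Ctx R p t u → Ctx R (𝟐 ∷ p) (app s t) (app s u)

  data BetaRedex : TermRel (b ⊔ f) where
    beta : (t : Term (S ∷ []) T) (u : Tm S) → BetaRedex (app (lam t) u) (t ⟨ u ⟩)

  _→β_ : TermRel (b ⊔ f)
  s →β t = ∃[ p ] Ctx BetaRedex p s t

  --------------------------------------------------------------------
  -- Rules

  -- 𝓡 g ls t stands for g $ ls → t ∈ 𝓡.
  Rules : (r : Level) → Set (b ⊔ f ⊔ ℓsuc r)
  Rules r = (g : Fun) → Args (dom g) → Tm (base (cod g)) → Set r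

  data Instance (𝓡 : Rules r) : TermRel (b ⊔ f ⊔ r) where
    inst : {ls : Args (dom g)} {t : Tm (base (cod g))} → 𝓡 g ls t →
           (σ : Subst) → Dom σ ⊆FV (g $ ls) →
           Instance 𝓡 ((g $ ls) [ σ ]) (t [ σ ])

  RewriteAt : Rules r → Position → TermRel (b ⊔ f ⊔ r)
  RewriteAt 𝓡 p = Ctx (Instance 𝓡) p

  module _ {Ts : List Ty} (ts : Args Ts) where

    data PCC : Tm T → Set (b ⊔ f) where
      arg       : (i : T ∈ Ts) → PCC (lookup ts i)
      acc       : {us : Args (dom g)} → PCC (g $ us) →
                  (i : T ∈ dom g) → Acc g i → PCC (lookup us i)
      lam       : {u : Term (S ∷ []) T} (y : Var S) → y ∉FV u →
                  PCC (lam u) → y ∉FVs ts → PCC (u ⟨ free y ⟩)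
      app-left  : {u : Tm (S ⇒ T)} (y : Var S) →
                  PCC (app u (free y)) → y ∉FVs ts → y ∉FV u → PCC u
      app-right : {u : Tm U} (Us : List Ty) (y : Var (U ⇒ Us ⇒⃗ U)) →
                  PCC (app (free y) u) → y ∉FVs ts → y ∉FV u → PCC u

    Admissible : Tm T → Set (b ⊔ f)
    Admissible t = ∀ {S} (x : Var S) → x ∈FV t → PCC (free x)

  -- t ∣ p ▷ u: the subterm of t at p is u. On the way to p, any name x may
  -- be chosen for a bound variable provided the abstraction is λx of its body.
  infix 4 _∣_▷_

  data _∣_▷_ : Tm T → Position → Tm U → Set (b ⊔ f) where
    here : {t : Tm T} → t ∣ [] ▷ t
    lam  : {t : Term (S ∷ []) T} {u : Tm U} (x : Var S) → x ∉FV t →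
           t ⟨ free x ⟩ ∣ p ▷ u → lam t ∣ 𝟏 ∷ p ▷ u
    appˡ : {t : Tm (S ⇒ T)} {v : Tm S} {u : Tm U} →
           t ∣ p ▷ u → app t v ∣ 𝟏 ∷ p ▷ u
    appʳ : {t : Tm (S ⇒ T)} {v : Tm S} {u : Tm U} →
           v ∣ p ▷ u → app t v ∣ 𝟐 ∷ p ▷ u

  -- ArgAt t p u: t is h t₁ … tₙ and, for some i, u is tᵢ and p is 1ⁿ⁻ⁱ2.
  data ArgAt : Term Γ T → Position → Term Γ U → Set (b ⊔ f) where
    last : {t : Term Γ (S ⇒ T)} {u : Term Γ S} → ArgAt (app t u) (𝟐 ∷ []) u
    prev : {t : Term Γ (S ⇒ T)} {v : Term Γ S} {u : Term Γ U} →
           ArgAt t p u → ArgAt (app t v) (𝟏 ∷ p) u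

  module _ (𝓡 : Rules r) where

    Defined : Fun → Set (b ⊔ f ⊔ r)
    Defined g = ∃[ ls ] ∃[ t ] 𝓡 g ls t

    -- t is g t₁ … tₙ with g defined and n ≥ 0.
    data DefinedHead : Term Γ T → Set (b ⊔ f ⊔ r) where
      fun : Defined g → DefinedHead {Γ} (fun g)
      app : {t : Term Γ (S ⇒ T)} {u : Term Γ S} → DefinedHead t → DefinedHead (app t u)

    data FAP : Term Γ T → Position → Set (b ⊔ f ⊔ r) where
      lam  : {t : Term (S ∷ Γ) T} → FAP t p → FAP (lam t) (𝟏 ∷ p)
      head : {t : Term Γ T} → DefinedHead t → FAP t []
      arg  : {t : Term Γ T} {u : Term Γ U} → DefinedHead t →
             ArgAt t p u → FAP u q → FAP t (p ++ q)
      appˡ : {t : Term Γ (S ⇒ T)} {u : Term Γ S} → ¬ DefinedHead (app t u) →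
             FAP t p → FAP (app t u) (𝟏 ∷ p)
      appʳ : {t : Term Γ (S ⇒ T)} {u : Term Γ S} → ¬ DefinedHead (app t u) →
             FAP u p → FAP (app t u) (𝟐 ∷ p)

    AdmissibleRules : Set (b ⊔ f ⊔ r)
    AdmissibleRules = ∀ {g ls t} → 𝓡 g ls t → Admissible ls t

    FAPCondition : Set (b ⊔ f ⊔ r)
    FAPCondition = ∀ {g ls t} → 𝓡 g ls t → ∀ {p} → FAP t p →
      ∀ {U} {u : Tm U} → t ∣ p ▷ u →
      (∀ {S} (x : Var S) → x ∈FV u → x ∈FV t) × U ≡ base (cod g)

    -- Under FAPCondition, requiring u to have the type of g $ ls excludes
    -- nothing, and u does not depend on the names chosen in t ∣ p ▷ u.
    DP : Rules (b ⊔ f ⊔ r)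
    DP g ls u = ∃[ t ] ∃[ p ] 𝓡 g ls t × FAP t p × t ∣ p ▷ u

    _→ᵢ_ : TermRel (b ⊔ f ⊔ r)
    s →ᵢ t = ∃[ p ] p ≢ [] × RewriteAt 𝓡 p s t

    _→DPₕ_ : TermRel (b ⊔ f ⊔ r)
    _→DPₕ_ = RewriteAt DP []

    _→C_ : TermRel (b ⊔ f ⊔ r)
    s →C t = ∃[ u ] Star _→ᵢ_ s u × u →DPₕ t

    _→βC_ : TermRel (b ⊔ f ⊔ r)
    _→βC_ = _→β_ ∪ _→C_

  --------------------------------------------------------------------
  -- Reduction pairs: relations between terms of possibly distinct types

  StableBySubst : IRel Tm ℓ → Set (b ⊔ f ⊔ ℓ)
  StableBySubst _≻_ = ∀ {T U} {s : Tm T} {t : Tm U} (σ : Subst) → FiniteDomain σ →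
    s ≻ t → (s [ σ ]) ≻ (t [ σ ])

  StableByContext : IRel Tm ℓ → Set (b ⊔ f ⊔ ℓ)
  StableByContext _≻_ = ∀ {T p} {s t : Tm T} → Ctx (λ {S} → _≻_ {S} {S}) p s t → s ≻ t

  record ReductionPair (_>_ : IRel Tm ℓ₁) (_≥_ : IRel Tm ℓ₂) : Set (b ⊔ f ⊔ ℓ₁ ⊔ ℓ₂) where
    field
      >-wellFounded : Terminating {A = ∃ Tm} (λ s t → proj₂ s > proj₂ t)
      >-subst       : StableBySubst _>_
      ≥-refl        : Reflexive Tm _≥_
      ≥-trans       : Transitive Tm _≥_
      ≥-subst       : StableBySubst _≥_
      ≥-context     : StableByContext _≥_
      →β⊆≥          : ∀ {T} {s t : Tm T} → s →β t → s ≥ t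
      ≥∘>⊆>         : ∀ {S T U} {s : Tm S} {t : Tm T} {u : Tm U} → s ≥ t → t > u → s > u

{-# OPTIONS --safe #-}

-- A chain step s →C t gives s > t, and s →β t gives s ≥ t. Since →β is strongly
-- normalizing on simply typed terms (Tait's reducibility), every infinite
-- →βC-sequence has a →C-step after any given index; by ≥ ∘ > ⊆ > it therefore
-- yields an infinite >-sequence.

module Submission where

open import Defs
open import Relation.Binary.Indexed.Heterogeneous using (IRel)
open import Data.Empty using (⊥; ⊥-elim)
open import Data.List.Base using (List; []; _∷_; _++_)
open import Data.List.Membership.Propositional using (_∈_)
open import Data.List.Membership.Propositional.Properties using (∈-++⁺ˡ; ∈-++⁺ʳ)
open import Data.List.Relation.Unary.Any using (here; there)
open import Data.Nat.Base using (ℕ; zero; suc)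
open import Data.Product.Base using (∃; ∃-syntax; _×_; _,_; proj₁; proj₂)
open import Data.Sum.Base using (_⊎_; inj₁; inj₂)
open import Data.Unit.Base using (⊤; tt)
open import Induction.WellFounded as WF using ()
open import Relation.Binary.Construct.Closure.ReflexiveTransitive using (Star; ε; _◅_)
open import Relation.Binary.PropositionalEquality.Core
  using (_≡_; refl; sym; trans; cong; cong₂; subst)
open import Relation.Nullary.Negation.Core using (¬_)
open import Level using (_⊔_)

module _ {b f} (𝓢 : Signature b f) where

  open HigherOrder 𝓢

  private
    variable
      S T U V   : Ty
      Γ Δ Θ     : List Ty
      p         : Position

  -- Substitution for de Bruijn indices.

  infixl 9 _⟪_⟫

  -- Named variables stay fixed, also under binders: `liftᶠ free` computes to `free`.
  _⟪_⟫ : Term Γ T → BoundSub Γ Δ → Term Δ T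
  t ⟪ β ⟫ = sub β free t

  infixr 5 _∙_

  _∙_ : Term Δ S → BoundSub Γ Δ → BoundSub (S ∷ Γ) Δ
  (u ∙ β) (here refl) = u
  (u ∙ β) (there i)   = β i

  -- Substitutions are functions, so they are compared pointwise rather than by `_≡_`. The
  -- composition laws below likewise take the composite as a parameter with a pointwise hypothesis,
  -- which passes under binders.
  ⟪⟫-cong : {β γ : BoundSub Γ Δ} → (∀ {S} (i : S ∈ Γ) → β i ≡ γ i) →
            (t : Term Γ T) → t ⟪ β ⟫ ≡ t ⟪ γ ⟫
  ⟪⟫-cong e (free x)  = refl
  ⟪⟫-cong e (bound i) = e i
  ⟪⟫-cong e (fun g)   = refl
  ⟪⟫-cong {Γ = Γ} {β = β} {γ} e (lam {S = S} t) = cong lam (⟪⟫-cong e′ t)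
    where
    e′ : ∀ {U} (i : U ∈ S ∷ Γ) → liftᵇ β i ≡ liftᵇ γ i
    e′ (here refl) = refl
    e′ (there i)   = cong (ren there) (e i)
  ⟪⟫-cong e (app t u) = cong₂ app (⟪⟫-cong e t) (⟪⟫-cong e u)

  ⟪bound⟫ : {β : BoundSub Γ Γ} → (∀ {S} (i : S ∈ Γ) → β i ≡ bound i) →
            (t : Term Γ T) → t ⟪ β ⟫ ≡ t
  ⟪bound⟫ e (free x)  = refl
  ⟪bound⟫ e (bound i) = e i
  ⟪bound⟫ e (fun g)   = refl
  ⟪bound⟫ {Γ = Γ} {β = β} e (lam {S = S} t) = cong lam (⟪bound⟫ e′ t)
    where
    e′ : ∀ {U} (i : U ∈ S ∷ Γ) → liftᵇ β i ≡ bound i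
    e′ (here refl) = refl
    e′ (there i)   = cong (ren there) (e i)
  ⟪bound⟫ e (app t u) = cong₂ app (⟪bound⟫ e t) (⟪bound⟫ e u)

  ren-⟪⟫ : {ρ : Ren Γ Δ} {β : BoundSub Δ Θ} {γ : BoundSub Γ Θ} →
           (∀ {S} (i : S ∈ Γ) → β (ρ i) ≡ γ i) →
           (t : Term Γ T) → ren ρ t ⟪ β ⟫ ≡ t ⟪ γ ⟫
  ren-⟪⟫ e (free x)  = refl
  ren-⟪⟫ e (bound i) = e i
  ren-⟪⟫ e (fun g)   = refl
  ren-⟪⟫ {Γ = Γ} {ρ = ρ} {β} {γ} e (lam {S = S} t) = cong lam (ren-⟪⟫ e′ t)
    where
    e′ : ∀ {U} (i : U ∈ S ∷ Γ) → liftᵇ β (liftᵣ ρ i) ≡ liftᵇ γ i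
    e′ (here refl) = refl
    e′ (there i)   = cong (ren there) (e i)
  ren-⟪⟫ e (app t u) = cong₂ app (ren-⟪⟫ e t) (ren-⟪⟫ e u)

  ren≡⟪⟫ : (ρ : Ren Γ Δ) (t : Term Γ T) → ren ρ t ≡ t ⟪ (λ i → bound (ρ i)) ⟫
  ren≡⟪⟫ ρ t = trans (sym (⟪bound⟫ (λ _ → refl) (ren ρ t))) (ren-⟪⟫ (λ _ → refl) t)

  -- Both sides are `t` with `bound (there (ρ i))` substituted for each index `i`.
  ren-ren-there : (ρ : Ren Γ Δ) (t : Term Γ T) →
                  ren (liftᵣ {U = U} ρ) (ren there t) ≡ ren there (ren ρ t)
  ren-ren-there ρ t =
    trans (ren≡⟪⟫ (liftᵣ ρ) (ren there t))
      (trans (ren-⟪⟫ (λ _ → refl) t)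
        (sym (trans (ren≡⟪⟫ there (ren ρ t)) (ren-⟪⟫ (λ _ → refl) t))))

  ⟪⟫-ren : {ρ : Ren Δ Θ} {β : BoundSub Γ Δ} {γ : BoundSub Γ Θ} →
           (∀ {S} (i : S ∈ Γ) → ren ρ (β i) ≡ γ i) →
           (t : Term Γ T) → ren ρ (t ⟪ β ⟫) ≡ t ⟪ γ ⟫
  ⟪⟫-ren e (free x)  = refl
  ⟪⟫-ren e (bound i) = e i
  ⟪⟫-ren e (fun g)   = refl
  ⟪⟫-ren {Γ = Γ} {ρ = ρ} {β} {γ} e (lam {S = S} t) = cong lam (⟪⟫-ren e′ t)
    where
    e′ : ∀ {U} (i : U ∈ S ∷ Γ) → ren (liftᵣ ρ) (liftᵇ β i) ≡ liftᵇ γ i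
    e′ (here refl) = refl
    e′ (there i)   = trans (ren-ren-there ρ (β i)) (cong (ren there) (e i))
  ⟪⟫-ren e (app t u) = cong₂ app (⟪⟫-ren e t) (⟪⟫-ren e u)

  ⟪⟫-⟪⟫ : {β : BoundSub Γ Δ} {γ : BoundSub Δ Θ} {δ : BoundSub Γ Θ} →
          (∀ {S} (i : S ∈ Γ) → β i ⟪ γ ⟫ ≡ δ i) →
          (t : Term Γ T) → t ⟪ β ⟫ ⟪ γ ⟫ ≡ t ⟪ δ ⟫
  ⟪⟫-⟪⟫ e (free x)  = refl
  ⟪⟫-⟪⟫ e (bound i) = e i
  ⟪⟫-⟪⟫ e (fun g)   = refl
  ⟪⟫-⟪⟫ {Γ = Γ} {β = β} {γ} {δ} e (lam {S = S} t) = cong lam (⟪⟫-⟪⟫ e′ t)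
    where
    e′ : ∀ {U} (i : U ∈ S ∷ Γ) → liftᵇ β i ⟪ liftᵇ γ ⟫ ≡ liftᵇ δ i
    e′ (here refl) = refl
    -- `β i` under the substitution `ren there (γ j)` for `j` is the common value of shifting before
    -- and after `γ`.
    e′ (there i)   = trans (ren-⟪⟫ (λ _ → refl) (β i))
      (trans (sym (⟪⟫-ren (λ _ → refl) (β i))) (cong (ren there) (e i)))
  ⟪⟫-⟪⟫ e (app t u) = cong₂ app (⟪⟫-⟪⟫ e t) (⟪⟫-⟪⟫ e u)

  lift-∙ : (β : BoundSub Γ Δ) (u : Term Δ S) (t : Term (S ∷ Γ) T) →
           t ⟪ liftᵇ β ⟫ ⟪ u ∙ bound ⟫ ≡ t ⟪ u ∙ β ⟫
  lift-∙ {Γ = Γ} {S = S} β u = ⟪⟫-⟪⟫ e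
    where
    e : ∀ {U} (i : U ∈ S ∷ Γ) → liftᵇ β i ⟪ u ∙ bound ⟫ ≡ (u ∙ β) i
    e (here refl) = refl
    e (there i)   = trans (ren-⟪⟫ (λ _ → refl) (β i)) (⟪bound⟫ (λ _ → refl) (β i))

  -- Both sides are `t ⟪ u ⟪ β ⟫ ∙ β ⟫`. This is what makes β-contraction commute with substitution.
  ∙-⟪⟫ : (β : BoundSub Γ Δ) (u : Term Γ S) (t : Term (S ∷ Γ) T) →
         t ⟪ u ∙ bound ⟫ ⟪ β ⟫ ≡ t ⟪ liftᵇ β ⟫ ⟪ u ⟪ β ⟫ ∙ bound ⟫
  ∙-⟪⟫ {Γ = Γ} {S = S} β u t = trans (⟪⟫-⟪⟫ e t) (sym (lift-∙ β (u ⟪ β ⟫) t))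
    where
    e : ∀ {U} (i : U ∈ S ∷ Γ) → (u ∙ bound) i ⟪ β ⟫ ≡ (u ⟪ β ⟫ ∙ β) i
    e (here refl) = refl
    e (there i)   = refl

  ⟨⟩≡⟪⟫ : (t : Term (S ∷ []) T) (u : Tm S) → t ⟨ u ⟩ ≡ t ⟪ u ∙ bound ⟫
  ⟨⟩≡⟪⟫ {S = S} t u = ⟪⟫-cong e t
    where
    e : ∀ {U} (i : U ∈ S ∷ []) → bound i ⟨ u ⟩ ≡ (u ∙ bound) i
    e (here refl) = refl

  -- β-reduction without names for bound variables.

  infix 4 _⟶_

  data _⟶_ : Term Γ T → Term Γ T → Set (b ⊔ f) where
    beta : (t : Term (S ∷ Γ) T) (u : Term Γ S) → app (lam t) u ⟶ t ⟪ u ∙ bound ⟫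
    lam  : {s t : Term (S ∷ Γ) T} → s ⟶ t → lam s ⟶ lam t
    appˡ : {s t : Term Γ (S ⇒ T)} {u : Term Γ S} → s ⟶ t → app s u ⟶ app t u
    appʳ : {s : Term Γ (S ⇒ T)} {t u : Term Γ S} → t ⟶ u → app s t ⟶ app s u

  ⟶-⟪⟫ : (β : BoundSub Γ Δ) {s t : Term Γ T} → s ⟶ t → s ⟪ β ⟫ ⟶ t ⟪ β ⟫
  ⟶-⟪⟫ β (beta t u) = subst (app (lam t) u ⟪ β ⟫ ⟶_) (sym (∙-⟪⟫ β u t)) (beta _ _)
  ⟶-⟪⟫ β (lam r)    = lam (⟶-⟪⟫ (liftᵇ β) r)
  ⟶-⟪⟫ β (appˡ r)   = appˡ (⟶-⟪⟫ β r)
  ⟶-⟪⟫ β (appʳ r)   = appʳ (⟶-⟪⟫ β r)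

  -- Inversion by equations serves sources such as `app (s ⟪ β ⟫) (u ⟪ β ⟫)`, where matching on
  -- `beta` would have to unify `lam t` with `s ⟪ β ⟫`.
  app-⟶ : {t : Term Γ (S ⇒ T)} {u : Term Γ S} {v : Term Γ T} → app t u ⟶ v →
          (∃[ s ] t ≡ lam s × v ≡ s ⟪ u ∙ bound ⟫) ⊎
          (∃[ t′ ] v ≡ app t′ u × t ⟶ t′) ⊎
          (∃[ u′ ] v ≡ app t u′ × u ⟶ u′)
  app-⟶ (beta s u) = inj₁ (s , refl , refl)
  app-⟶ (appˡ r)   = inj₂ (inj₁ (_ , refl , r))
  app-⟶ (appʳ r)   = inj₂ (inj₂ (_ , refl , r))

  app-injective : {s : Term Γ (U ⇒ T)} {u : Term Γ U} {t : Term Γ (V ⇒ T)} {v : Term Γ V} →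
                  app s u ≡ app t v →
                  ∃[ e ] subst (λ U → Term Γ (U ⇒ T)) e s ≡ t × subst (Term Γ) e u ≡ v
  app-injective refl = refl , refl , refl

  -- IsFun and IsLam are computed from the term alone: at a type
  -- dom g ⇒⃗ base (cod g), case analysis on terms or reductions is stuck.

  IsFun : Term Γ T → Set
  IsFun (fun g) = ⊤
  IsFun _       = ⊥

  IsLam : Term Γ T → Set
  IsLam (lam t) = ⊤
  IsLam _       = ⊥

  IsLam⇒lam : (t : Term Γ (T ⇒ U)) → IsLam t → ∃[ s ] t ≡ lam s
  IsLam⇒lam t l = go t refl l
    where
    -- With a variable `V` for the type, the `fun` case splits without solving
    -- `dom g ⇒⃗ base (cod g) = T ⇒ U`.
    go : (t : Term Γ V) (e : V ≡ T ⇒ U) → IsLam t → ∃[ s ] subst (Term Γ) e t ≡ lam s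
    go (lam s) refl l = s , refl

  -- A symbol contains no index, so it can be moved to any context; this inverts `_⟪ β ⟫` on
  -- symbols.
  asFun : (t : Term Γ T) → IsFun t → Term Δ T
  asFun (fun g) _ = fun g

  fun-normal : {s t : Term Γ T} → s ⟶ t → ¬ IsFun s
  fun-normal (beta t u) ()
  fun-normal (lam r) ()
  fun-normal (appˡ r) ()
  fun-normal (appʳ r) ()

  -- Strong normalization by reducibility.

  SN : Term Γ T → Set (b ⊔ f)
  SN = WF.Acc (λ t s → s ⟶ t)

  -- Terms without dangling indices suffice: named variables inhabit every type, so no
  -- quantification over larger contexts occurs.
  Red : (T : Ty) → Tm T → Set (b ⊔ f)
  Red (base B) t = SN t
  Red (S ⇒ T)  t = ∀ u → Red S u → Red T (app t u)

  -- Every reduction of `t` is mirrored step by step in `t ⟪ β ⟫`.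
  SN-⟪⟫⁻ : (β : BoundSub Γ Δ) (t : Term Γ T) → SN (t ⟪ β ⟫) → SN t
  SN-⟪⟫⁻ β t (WF.acc h) = WF.acc λ r → SN-⟪⟫⁻ β _ (h (⟶-⟪⟫ β r))

  SN-appˡ : (t : Term Γ (S ⇒ T)) (u : Term Γ S) → SN (app t u) → SN t
  SN-appˡ t u (WF.acc h) = WF.acc λ r → SN-appˡ _ u (h (appˡ r))

  red-⟶ : ∀ T {s t : Tm T} → Red T s → s ⟶ t → Red T t
  red-⟶ (base B) (WF.acc h) r = h r
  red-⟶ (S ⇒ T)  h r = λ u hu → red-⟶ T (h u hu) (appˡ r)

  -- Simultaneous induction on types, where neutral means not an abstraction. A reducible function
  -- is normalizing because its application to a variable is; `red-app` adds an inner induction on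
  -- `SN u`, as reducing the argument keeps the application neutral.
  red⇒SN      : ∀ T {t : Tm T} → Red T t → SN t
  red-neutral : ∀ T (t : Tm T) → ¬ IsLam t → (∀ t′ → t ⟶ t′ → Red T t′) → Red T t
  red-app     : ∀ S T (t : Tm (S ⇒ T)) → ¬ IsLam t →
                (∀ t′ → t ⟶ t′ → Red (S ⇒ T) t′) →
                ∀ u → Red S u → SN u → Red T (app t u)
  red-free    : ∀ T (x : Var T) → Red T (free x)

  red⇒SN (base B) h = h
  red⇒SN (S ⇒ T)  h = SN-appˡ _ _ (red⇒SN T (h (free (var 0)) (red-free S (var 0))))

  red-neutral (base B) t n h = WF.acc λ r → h _ r
  red-neutral (S ⇒ T)  t n h u hu = red-app S T t n h u hu (red⇒SN S hu)

  red-app S T t n h u hu (WF.acc a) = red-neutral T (app t u) (λ ()) λ v r → step (app-⟶ r)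
    where
    step : ∀ {v} → _ → Red T v
    step (inj₁ (s , refl , e))           = ⊥-elim (n tt)
    step (inj₂ (inj₁ (t′ , refl , r)))   = h t′ r u hu
    step (inj₂ (inj₂ (u′ , refl , r)))   = red-app S T t n h u′ (red-⟶ S hu r) (a r)

  red-free T x = red-neutral T (free x) (λ ()) (λ _ ())

  -- The redex is itself neutral, so its reducts decide, by induction on `SN t` and `SN u`. Reducing
  -- the body preserves reducibility of its instances because reduction is stable by substitution.
  red-lam : ∀ S T (t : Term (S ∷ []) T) → (∀ u → Red S u → Red T (t ⟪ u ∙ bound ⟫)) →
            SN t → ∀ u → Red S u → SN u → Red T (app (lam t) u)
  red-lam S T t h (WF.acc a) u hu (WF.acc a′) =
    red-neutral T (app (lam t) u) (λ ()) λ where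
      _ (beta _ _)     → h u hu
      _ (appˡ (lam r)) → red-lam S T _
        (λ v hv → red-⟶ T (h v hv) (⟶-⟪⟫ (v ∙ bound) r)) (a r) u hu (WF.acc a′)
      _ (appʳ r)       → red-lam S T t h (WF.acc a) _ (red-⟶ S hu r) (a′ r)

  red-⟪⟫ : (t : Term Γ T) (β : BoundSub Γ []) → (∀ {S} (i : S ∈ Γ) → Red S (β i)) →
           Red T (t ⟪ β ⟫)
  red-⟪⟫ (free x)  β h = red-free _ x
  red-⟪⟫ (bound i) β h = h i
  red-⟪⟫ (fun g)   β h = red-neutral _ (fun g) (λ ()) λ _ r → ⊥-elim (fun-normal r tt)
  red-⟪⟫ {Γ = Γ} (lam {S} {T = T} t) β h u hu =
    -- The body has a dangling index, so `Red` does not apply to it; its normalization is reflected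
    -- from its instance at a named variable.
    red-lam S T (t ⟪ liftᵇ β ⟫) body (SN-⟪⟫⁻ (x ∙ bound) _ (red⇒SN T (body x (red-free S _))))
      u hu (red⇒SN S hu)
    where
    x : Tm S
    x = free (var 0)

    ∙-red : ∀ v → Red S v → ∀ {U} (i : U ∈ S ∷ Γ) → Red U ((v ∙ β) i)
    ∙-red v hv (here refl) = hv
    ∙-red v hv (there i)   = h i

    body : ∀ v → Red S v → Red T (t ⟪ liftᵇ β ⟫ ⟪ v ∙ bound ⟫)
    body v hv = subst (Red T) (sym (lift-∙ β v t)) (red-⟪⟫ t (v ∙ β) (∙-red v hv))
  red-⟪⟫ (app t u) β h = red-⟪⟫ t β h (u ⟪ β ⟫) (red-⟪⟫ u β h)

  strong-normalization : (t : Tm T) → SN t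
  strong-normalization t =
    subst SN (⟪bound⟫ (λ _ → refl) t) (red⇒SN _ (red-⟪⟫ t bound (λ ())))

  -- Naming a bound variable reflects β-reduction. Variables have no decidable
  -- equality, so there is no operation abstracting a name from a term; instead,
  -- reductions are lifted along the substitution, which is injective on terms
  -- not containing the name.

  data IsVar {S} (x : Var S) : Term Δ T → Set (b ⊔ f) where
    bound : (i : T ∈ Δ) → IsVar x (bound i)
    free  : IsVar x (free {Γ = Δ} x)

  -- A generalization of `free x ∙ bound` that is closed under `liftᵇ`, so that inductions can pass
  -- under binders.
  record Opening {S} (x : Var S) (β : BoundSub Γ Δ) : Set (b ⊔ f) where
    field
      isVar     : ∀ {T} (i : T ∈ Γ) → IsVar x (β i)
      injective : ∀ {T} (i j : T ∈ Γ) → β i ≡ β j → i ≡ j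

  open Opening

  opening-∙ : (x : Var S) → Opening x (free {Γ = []} x ∙ bound)
  opening-∙ x .isVar (here refl) = free
  opening-∙ x .injective (here refl) (here refl) e = refl

  opening-lift : {x : Var S} {β : BoundSub Γ Δ} → Opening x β → Opening x (liftᵇ {U = U} β)
  opening-lift o .isVar (here refl) = bound (here refl)
  opening-lift {β = β} o .isVar (there i) with β i | isVar o i
  ... | _ | bound j = bound (there j)
  ... | _ | free    = free
  opening-lift o .injective (here refl) (here refl) e = refl
  opening-lift {β = β} o .injective (here refl) (there j) e with β j | isVar o j
  opening-lift o .injective (here refl) (there j) () | _ | bound _
  opening-lift o .injective (here refl) (there j) () | _ | free
  opening-lift {β = β} o .injective (there i) (here refl) e with β i | isVar o i
  opening-lift o .injective (there i) (here refl) () | _ | bound _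
  opening-lift o .injective (there i) (here refl) () | _ | free
  opening-lift {x = x} {β} o .injective (there i) (there j) e =
    cong there (injective o i j (unshift (isVar o i) (isVar o j) e))
    where
    -- Injectivity of weakening, on the variables that an opening can produce.
    unshift : {s t : Term Δ T} → IsVar x s → IsVar x t →
              ren (there {x = U}) s ≡ ren there t → s ≡ t
    unshift (bound i) (bound .i) refl = refl
    unshift (bound i) free ()
    unshift free (bound i) ()
    unshift free free refl = refl

  module _ {S} {x : Var S} where

    lam-⟪⟫⁻ : {β : BoundSub Γ Δ} → Opening x β → (t : Term Γ T) → IsLam (t ⟪ β ⟫) → IsLam t
    lam-⟪⟫⁻ o (lam t) l = tt
    lam-⟪⟫⁻ {β = β} o (bound i) l with β i | isVar o i
    lam-⟪⟫⁻ o (bound i) () | _ | bound _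
    lam-⟪⟫⁻ o (bound i) () | _ | free

    lam-⟪⟫-inv : {β : BoundSub Γ Δ} → Opening x β →
                 (t : Term Γ (T ⇒ U)) {s : Term (T ∷ Δ) U} → t ⟪ β ⟫ ≡ lam s →
                 ∃[ t′ ] t ≡ lam t′ × t′ ⟪ liftᵇ β ⟫ ≡ s
    lam-⟪⟫-inv o t e with IsLam⇒lam t (lam-⟪⟫⁻ o t (subst IsLam (sym e) tt))
    lam-⟪⟫-inv o .(lam t′) refl | t′ , refl = t′ , refl , refl

    -- Only variables are put for indices, so no redex is created: each one in `s ⟪ β ⟫` comes from
    -- a redex of `s`.
    ⟶-⟪⟫⁻ : {β : BoundSub Γ Δ} → Opening x β → (s : Term Γ T) {t : Term Δ T} →
            s ⟪ β ⟫ ⟶ t → ∃[ s′ ] s ⟶ s′ × s′ ⟪ β ⟫ ≡ t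
    ⟶-⟪⟫⁻ o (free y) ()
    ⟶-⟪⟫⁻ {β = β} o (bound i) r with β i | isVar o i
    ⟶-⟪⟫⁻ o (bound i) () | _ | bound _
    ⟶-⟪⟫⁻ o (bound i) () | _ | free
    ⟶-⟪⟫⁻ o (fun g) r = ⊥-elim (fun-normal r tt)
    ⟶-⟪⟫⁻ o (lam s) (lam r) with ⟶-⟪⟫⁻ (opening-lift o) s r
    ... | s′ , r′ , refl = lam s′ , lam r′ , refl
    ⟶-⟪⟫⁻ {β = β} o (app s u) r with app-⟶ r
    ... | inj₁ (a , e , refl) with lam-⟪⟫-inv o s e
    ...   | a′ , refl , refl = a′ ⟪ u ∙ bound ⟫ , beta a′ u , ∙-⟪⟫ β u a′
    ⟶-⟪⟫⁻ o (app s u) r | inj₂ (inj₁ (_ , refl , r₁)) with ⟶-⟪⟫⁻ o s r₁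
    ...   | s′ , r′ , refl = app s′ u , appˡ r′ , refl
    ⟶-⟪⟫⁻ o (app s u) r | inj₂ (inj₂ (_ , refl , r₂)) with ⟶-⟪⟫⁻ o u r₂
    ...   | u′ , r′ , refl = app s u′ , appʳ r′ , refl

    asFun-⟪⟫ : {β : BoundSub Γ Δ} → Opening x β → (t : Term Γ T) (h : IsFun (t ⟪ β ⟫)) →
               asFun (t ⟪ β ⟫) h ≡ t
    asFun-⟪⟫ o (fun g) h = refl
    asFun-⟪⟫ {β = β} o (bound i) h with β i | isVar o i
    asFun-⟪⟫ o (bound i) () | _ | bound _
    asFun-⟪⟫ o (bound i) () | _ | free

    -- As `x` occurs in neither term, any `free x` in the images comes from an index, and
    -- `injective` tells indices apart.
    ⟪⟫-injective : {β : BoundSub Γ Δ} → Opening x β → (s t : Term Γ T) →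
                   x ∉FV s → x ∉FV t → s ⟪ β ⟫ ≡ t ⟪ β ⟫ → s ≡ t
    ⟪⟫-injective o (free y) (free .y) hs ht refl = refl
    ⟪⟫-injective {β = β} o (free y) (bound j) hs ht e with β j | isVar o j
    ⟪⟫-injective o (free y) (bound j) hs ht () | _ | bound _
    ⟪⟫-injective o (free y) (bound j) hs ht refl | _ | free = ⊥-elim (hs free)
    ⟪⟫-injective o (free y) (fun g) hs ht ()
    ⟪⟫-injective o (free y) (lam t) hs ht ()
    ⟪⟫-injective o (free y) (app t u) hs ht ()
    ⟪⟫-injective {β = β} o (bound i) (free y) hs ht e with β i | isVar o i
    ⟪⟫-injective o (bound i) (free y) hs ht () | _ | bound _
    ⟪⟫-injective o (bound i) (free y) hs ht refl | _ | free = ⊥-elim (ht free)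
    ⟪⟫-injective o (bound i) (bound j) hs ht e = cong bound (injective o i j e)
    ⟪⟫-injective {β = β} o (bound i) (fun g) hs ht e with β i | isVar o i
    ⟪⟫-injective o (bound i) (fun g) hs ht () | _ | bound _
    ⟪⟫-injective o (bound i) (fun g) hs ht () | _ | free
    ⟪⟫-injective {β = β} o (bound i) (lam t) hs ht e with β i | isVar o i
    ⟪⟫-injective o (bound i) (lam t) hs ht () | _ | bound _
    ⟪⟫-injective o (bound i) (lam t) hs ht () | _ | free
    ⟪⟫-injective {β = β} o (bound i) (app t u) hs ht e with β i | isVar o i
    ⟪⟫-injective o (bound i) (app t u) hs ht () | _ | bound _
    ⟪⟫-injective o (bound i) (app t u) hs ht () | _ | free
    ⟪⟫-injective {β = β} o (fun g) t hs ht e = lemma (t ⟪ β ⟫) e (asFun-⟪⟫ o t)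
      where
      -- Abstracting `t ⟪ β ⟫` to `u` allows matching on the equation; `asFun` then reads `t` off
      -- `fun g`.
      lemma : ∀ u → fun g ≡ u → (∀ h → asFun u h ≡ t) → fun g ≡ t
      lemma _ refl h = h tt
    ⟪⟫-injective o (lam s) t hs ht e with lam-⟪⟫-inv o t (sym e)
    ... | t′ , refl , e′ =
      cong lam (⟪⟫-injective (opening-lift o) s t′ (λ h → hs (lam h)) (λ h → ht (lam h)) (sym e′))
    ⟪⟫-injective o (app s u) (free y) hs ht ()
    ⟪⟫-injective {β = β} o (app s u) (bound i) hs ht e with β i | isVar o i
    ⟪⟫-injective o (app s u) (bound i) hs ht () | _ | bound _
    ⟪⟫-injective o (app s u) (bound i) hs ht () | _ | free
    ⟪⟫-injective o (app s u) (fun g) hs ht ()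
    ⟪⟫-injective o (app s u) (lam t) hs ht ()
    ⟪⟫-injective o (app s u) (app t v) hs ht e with app-injective e
    ... | refl , e₁ , e₂ =
      cong₂ app (⟪⟫-injective o s t (λ h → hs (appˡ h)) (λ h → ht (appˡ h)) e₁)
                (⟪⟫-injective o u v (λ h → hs (appʳ h)) (λ h → ht (appʳ h)) e₂)

    ∈FV⇒¬IsFun : {t : Term Γ T} → x ∈FV t → ¬ IsFun t
    ∈FV⇒¬IsFun free ()
    ∈FV⇒¬IsFun (lam h) ()
    ∈FV⇒¬IsFun (appˡ h) ()
    ∈FV⇒¬IsFun (appʳ h) ()

    ∈FV-ren⁻ : (ρ : Ren Γ Δ) (t : Term Γ T) → x ∈FV ren ρ t → x ∈FV t
    ∈FV-ren⁻ ρ (free y)  free     = free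
    ∈FV-ren⁻ ρ (fun g)   h        = ⊥-elim (∈FV⇒¬IsFun h tt)
    ∈FV-ren⁻ ρ (lam t)   (lam h)  = lam (∈FV-ren⁻ (liftᵣ ρ) t h)
    ∈FV-ren⁻ ρ (app t u) (appˡ h) = appˡ (∈FV-ren⁻ ρ t h)
    ∈FV-ren⁻ ρ (app t u) (appʳ h) = appʳ (∈FV-ren⁻ ρ u h)

    ∈FV-free : {y : Var T} → x ∈FV free {Γ = Δ} y → x ∈FV free {Γ = Γ} y
    ∈FV-free free = free

    ∉FV-⟪⟫ : (β : BoundSub Γ Δ) (t : Term Γ T) →
             (∀ {U} (i : U ∈ Γ) → x ∉FV β i) → x ∉FV t → x ∉FV t ⟪ β ⟫
    ∉FV-⟪⟫ β (free y)  hβ ht h        = ht (∈FV-free h)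
    ∉FV-⟪⟫ β (bound i) hβ ht h        = hβ i h
    ∉FV-⟪⟫ β (fun g)   hβ ht h        = ∈FV⇒¬IsFun h tt
    ∉FV-⟪⟫ {Γ = Γ} β (lam {S = U} t) hβ ht (lam h) =
      ∉FV-⟪⟫ (liftᵇ β) t hβ′ (λ h → ht (lam h)) h
      where
      hβ′ : ∀ {V} (i : V ∈ U ∷ Γ) → x ∉FV liftᵇ β i
      hβ′ (here refl) ()
      hβ′ (there i) h = hβ i (∈FV-ren⁻ there (β i) h)
    ∉FV-⟪⟫ β (app t u) hβ ht (appˡ h) = ∉FV-⟪⟫ β t hβ (λ h → ht (appˡ h)) h
    ∉FV-⟪⟫ β (app t u) hβ ht (appʳ h) = ∉FV-⟪⟫ β u hβ (λ h → ht (appʳ h)) h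

    ∉FV-⟶ : {s t : Term Γ T} → s ⟶ t → x ∉FV s → x ∉FV t
    ∉FV-⟶ {Γ = Γ} (beta {S = U} t u) hs = ∉FV-⟪⟫ (u ∙ bound) t h∙ (λ h → hs (appˡ (lam h)))
      where
      h∙ : ∀ {V} (i : V ∈ U ∷ Γ) → x ∉FV (u ∙ bound) i
      h∙ (here refl) h = hs (appʳ h)
      h∙ (there i) ()
    ∉FV-⟶ (lam r)  hs (lam h)  = ∉FV-⟶ r (λ h → hs (lam h)) h
    ∉FV-⟶ (appˡ r) hs (appˡ h) = ∉FV-⟶ r (λ h → hs (appˡ h)) h
    ∉FV-⟶ (appˡ r) hs (appʳ h) = hs (appʳ h)
    ∉FV-⟶ (appʳ r) hs (appˡ h) = hs (appˡ h)
    ∉FV-⟶ (appʳ r) hs (appʳ h) = ∉FV-⟶ r (λ h → hs (appʳ h)) h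

    -- The step pulls back to some `s ⟶ s′`. Reduction creates no free variable, so `x` is not in
    -- `s′`, and injectivity gives `s′ ≡ t`.
    close-⟶ : {s t : Term (S ∷ []) T} → x ∉FV s → x ∉FV t →
              s ⟨ free x ⟩ ⟶ t ⟨ free x ⟩ → s ⟶ t
    close-⟶ {s = s} {t} hs ht r
      with ⟶-⟪⟫⁻ (opening-∙ x) s
             (subst (_⟶ t ⟨ free x ⟩) (⟨⟩≡⟪⟫ s (free x)) r)
    ... | s′ , r′ , e = subst (s ⟶_)
      (⟪⟫-injective (opening-∙ x) s′ t (∉FV-⟶ r′ hs) ht (trans e (⟨⟩≡⟪⟫ t (free x)))) r′

  →β⇒⟶ : {s t : Tm T} → Ctx BetaRedex p s t → s ⟶ t
  →β⇒⟶ (top (beta t u))     = subst (app (lam t) u ⟶_) (sym (⟨⟩≡⟪⟫ t u)) (beta t u)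
  →β⇒⟶ (lam x hs ht r)      = lam (close-⟶ hs ht (→β⇒⟶ r))
  →β⇒⟶ (appˡ r)             = appˡ (→β⇒⟶ r)
  →β⇒⟶ (appʳ r)             = appʳ (→β⇒⟶ r)

  -- Finite domains of matching substitutions.

  fv : Term Γ T → List (∃ Var)
  fv (free x)  = (_ , x) ∷ []
  fv (bound i) = []
  fv (fun g)   = []
  fv (lam t)   = fv t
  fv (app t u) = fv t ++ fv u

  ∈FV⇒∈fv : {x : Var S} {t : Term Γ T} → x ∈FV t → (S , x) ∈ fv t
  ∈FV⇒∈fv free                     = here refl
  ∈FV⇒∈fv (lam h)                  = ∈FV⇒∈fv h
  ∈FV⇒∈fv (appˡ h)                 = ∈-++⁺ˡ (∈FV⇒∈fv h)
  ∈FV⇒∈fv (appʳ {t = t} h)         = ∈-++⁺ʳ (fv t) (∈FV⇒∈fv h)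

  -- Stability of a reduction pair is assumed for finite domains; a matching substitution moves only
  -- variables of the left-hand side.
  dom⇒finite : (σ : Subst) (t : Tm T) → Dom σ ⊆FV t → FiniteDomain σ
  dom⇒finite σ t h = fv t , λ x x∉ → h x (λ x∈ → x∉ (∈FV⇒∈fv x∈))

  Ctx-map : ∀ {ℓ₁ ℓ₂} {P : TermRel ℓ₁} {Q : TermRel ℓ₂} →
            (∀ {U} {s t : Tm U} → P s t → Q s t) →
            {s t : Tm T} → Ctx P p s t → Ctx Q p s t
  Ctx-map h (top r)         = top (h r)
  Ctx-map h (lam x hs ht r) = lam x hs ht (Ctx-map h r)
  Ctx-map h (appˡ r)        = appˡ (Ctx-map h r)
  Ctx-map h (appʳ r)        = appʳ (Ctx-map h r)

  -- Descent along an infinite sequence.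

  module _ {r ℓ₁ ℓ₂} (𝓡 : Rules r) (_>_ : IRel Tm ℓ₁) (_≥_ : IRel Tm ℓ₂)
           (pair : ReductionPair _>_ _≥_)
           (𝓡⊆≥ : ∀ {g ls t} → 𝓡 g ls t → (g $ ls) ≥ t)
           (DP⊆> : ∀ {g ls t} → DP 𝓡 g ls t → (g $ ls) > t) where

    open ReductionPair pair

    instance⊆≥ : {s t : Tm T} → Instance 𝓡 s t → s ≥ t
    instance⊆≥ (inst rule σ h) = ≥-subst σ (dom⇒finite σ _ h) (𝓡⊆≥ rule)

    →ᵢ*⊆≥ : {s t : Tm T} → Star (_→ᵢ_ 𝓡) s t → s ≥ t
    →ᵢ*⊆≥ ε                   = ≥-refl
    →ᵢ*⊆≥ ((_ , _ , c) ◅ rs)  = ≥-trans (≥-context (Ctx-map instance⊆≥ c)) (→ᵢ*⊆≥ rs)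

    →DPₕ⊆> : {s t : Tm T} → _→DPₕ_ 𝓡 s t → s > t
    →DPₕ⊆> (top (inst dp σ h)) = >-subst σ (dom⇒finite σ _ h) (DP⊆> dp)

    →C⊆> : {s t : Tm T} → _→C_ 𝓡 s t → s > t
    →C⊆> (_ , rs , d) = ≥∘>⊆> (→ᵢ*⊆≥ rs) (→DPₕ⊆> d)

    module _ (s : ℕ → Tm T) (steps : ∀ n → _→βC_ 𝓡 (s n) (s (suc n))) where

      -- Induction on `SN (s n)`: each β-step uses it up, so a chain step is reached, and the
      -- β-steps before it are absorbed on the left of `>`.
      descend : ∀ n → SN (s n) → ∃[ m ] s n > s m
      descend n (WF.acc h) with steps n
      ... | inj₂ c       = suc n , →C⊆> c
      ... | inj₁ (p , c) with descend (suc n) (h (→β⇒⟶ c))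
      ...   | m , d = m , ≥∘>⊆> (→β⊆≥ (p , c)) d

      descent : ∀ n → ∃[ m ] s n > s m
      descent n = descend n (strong-normalization (s n))

      -- Iterated choice of descents; consecutive terms are related by `>`, whatever the order of
      -- the indices.
      index : ℕ → ℕ
      index zero    = zero
      index (suc k) = proj₁ (descent (index k))

      no-infinite-sequence : ⊥
      no-infinite-sequence =
        >-wellFounded ((λ k → _ , s (index k)) , λ k → proj₂ (descent (index k)))

theorem5 : ∀ {b f r ℓ₁ ℓ₂} (𝓢 : Signature b f) → let open HigherOrder 𝓢 in
    (𝓡 : Rules r) → AdmissibleRules 𝓡 → FAPCondition 𝓡 →
    (_>_ : IRel Tm ℓ₁) (_≥_ : IRel Tm ℓ₂) → ReductionPair _>_ _≥_ →
    (∀ {g ls t} → 𝓡 g ls t → (g $ ls) ≥ t) →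
    (∀ {g ls t} → DP 𝓡 g ls t → (g $ ls) > t) →
    ∀ {T} → Terminating (_→βC_ 𝓡 {T})
theorem5 𝓢 𝓡 _ _ _>_ _≥_ pair 𝓡⊆≥ DP⊆> (s , steps) =
  no-infinite-sequence 𝓢 𝓡 _>_ _≥_ pair 𝓡⊆≥ DP⊆> s steps
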